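{- Let $\mathcal{K}$ be a subcanonical AP class consisting of finite structures; that is, $|A|$ is a finite set for every object $A\in\mathcal{K}$. Then the following are equivalent: (1) For every connected component $\mathcal{K}'$ of $\mathcal{K}$, there exists a number $b\in\mathbb{N}$ such that every object $A\in\mathcal{K}'$ has cardinality at most $b$. (2) $\mathrm{Sh}(\mathcal{K}^{\mathrm{op}},J_{\mathrm{at}})$ satisfies the internal axiom of countable choice. (3) $\mathrm{Sh}(\mathcal{K}^{\mathrm{op}},J_{\mathrm{at}})$ satisfies the internal axiom of dependent choice. (4) $\mathrm{Sh}(\mathcal{K}^{\mathrm{op}},J_{\mathrm{at}})$ satisfies the internal axiom of choice.
   Context: A structure-class is a category $\mathcal{K}$ with a faithful functor $|-|:\mathcal{K}\to\mathbf{Set}$ such that: (i) for each morphism $f$, $|f|$ is injective; (ii) if $|f|$ is a bijection then $f$ is an isomorphism; (iii) (transportability) for each object $A$ and bijection $\sigma:|A|\to X$ there is an isomorphism $\bar\sigma:A\to A^\sigma$ in $\mathcal{K}$ with $|A^\sigma|=X$, $|\bar\sigma|=\sigma$; (iv) for each set $X$ the objects $A$ with $|A|=X$ form a set. Objects are called structures and morphisms embeddings. A structure-class of finite structures is essentially small, and (pre)sheaves on $\mathcal{K}^{\mathrm{op}}$ are taken over an equivalent small category. Amalgamation property (AP): for all $f:A\to B$, $g:A\to C$ in $\mathcal{K}$ there are $h:B\to D$, $k:C\to D$ in $\mathcal{K}$ with $hf=kg$. Coherence axiom: for all morphisms $g:A\to C$, $h:B\to C$ and every function $f:|A|\to|B|$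 with $|g|=|h|\circ f$ there is a morphism $\bar f:A\to B$ with $|\bar f|=f$. The atomic topology $J_{\mathrm{at}}$ on $\mathcal{K}^{\mathrm{op}}$ is the Grothendieck topology whose covering families are exactly the nonempty families. It is subcanonical if every representable presheaf is a sheaf. $\mathcal{K}$ is a subcanonical AP class if it is a structure-class satisfying the coherence axiom and the AP, and $J_{\mathrm{at}}$ on $\mathcal{K}^{\mathrm{op}}$ is subcanonical. The connected components of a category are those of the undirected graph obtained by disregarding the direction of morphisms. In a topos: the internal axiom of countable choice is the axiom of choice for $\omega$-indexed families, i.e. for every countably infinite family of epimorphisms $g_i:X_i\to Y_i$ the product $\prod_ig_i:\prod_iX_i\to\prod_iY_i$ is an epimorphism; the internal axiom of dependent choice says that for every sequence of epimorphisms $\cdots\to X_2\to X_1\to X_0$ the projection $\lim_nX_n\to X_0$ is an epimorphism; the internal axiom of choice says that for every epimorphism $g:X\to Y$ and every object $Z$, $g^Z:X^Z\to Y^Z$ is an epimorphism. -}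

module Defs where

open import Axiom.Extensionality.Propositional using (Extensionality)
open import Axiom.UniquenessOfIdentityProofs.WithK using (uip)
open import Data.Fin.Base using (Fin)
open import Data.Nat.Base using (ℕ; zero; suc; _≤_)
open import Data.Product using (Σ; ∃; ∃!; _×_; _,_; proj₁; proj₂)
open import Function.Base using (id)
open import Function.Bundles using (_↔_; Inverse)
open import Function.Definitions using (Injective; Surjective; Bijective)
open import Level using (Level; Lift; lift; lower; Setω) renaming (suc to lsuc; _⊔_ to _⊔ˡ_)
open import Relation.Binary.Construct.Closure.Equivalence using (EqClosure)
open import Relation.Binary.PropositionalEquality
  using (_≡_; refl; sym; trans; cong; cong₂; subst; module ≡-Reasoning)

-- Sets are Agda types with propositional equality (axiom K makes every type a
-- set).  Function extensionality, which Agda lacks, is passed as an argument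
-- wherever maps have to be compared.
FunExt : Setω
FunExt = ∀ {a b} → Extensionality a b

------------------------------------------------------------------------
-- Categories

record Category (o h : Level) : Set (lsuc (o ⊔ˡ h)) where
  infixr 9 _∘_
  field
    Obj   : Set o
    Hom   : Obj → Obj → Set h
    idm   : ∀ {A} → Hom A A
    _∘_   : ∀ {A B C} → Hom B C → Hom A B → Hom A C
    idˡ   : ∀ {A B} (f : Hom A B) → idm ∘ f ≡ f
    idʳ   : ∀ {A B} (f : Hom A B) → f ∘ idm ≡ f
    assoc : ∀ {A B C D} (f : Hom A B) (g : Hom B C) (k : Hom C D) →
            (k ∘ g) ∘ f ≡ k ∘ (g ∘ f)

  record IsIso {A B : Obj} (f : Hom A B) : Set h where
    field
      inv  : Hom B A
      invˡ : inv ∘ f ≡ idm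
      invʳ : f ∘ inv ≡ idm

  Epi : ∀ {A B} → Hom A B → Set (o ⊔ˡ h)
  Epi {A} {B} f = ∀ {W} (u v : Hom B W) → u ∘ f ≡ v ∘ f → u ≡ v

op : ∀ {o h} → Category o h → Category o h
op 𝒞 = record
  { Obj   = Obj
  ; Hom   = λ A B → Hom B A
  ; idm   = idm
  ; _∘_   = λ f g → g ∘ f
  ; idˡ   = idʳ
  ; idʳ   = idˡ
  ; assoc = λ f g k → sym (assoc k g f)
  }
  where open Category 𝒞

Sets : ∀ ℓ → Category (lsuc ℓ) ℓ
Sets ℓ = record
  { Obj   = Set ℓ
  ; Hom   = λ X Y → X → Y
  ; idm   = λ x → x
  ; _∘_   = λ g f x → g (f x)
  ; idˡ   = λ _ → refl
  ; idʳ   = λ _ → refl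
  ; assoc = λ _ _ _ → refl
  }

record Functor {o h o′ h′} (𝒞 : Category o h) (𝒟 : Category o′ h′)
       : Set (o ⊔ˡ h ⊔ˡ o′ ⊔ˡ h′) where
  private
    module C = Category 𝒞
    module D = Category 𝒟
  field
    F₀     : C.Obj → D.Obj
    F₁     : ∀ {A B} → C.Hom A B → D.Hom (F₀ A) (F₀ B)
    F-id   : ∀ {A} → F₁ (C.idm {A}) ≡ D.idm
    F-comp : ∀ {A B C} (g : C.Hom B C) (f : C.Hom A B) →
             F₁ (g C.∘ f) ≡ F₁ g D.∘ F₁ f

Faithful : ∀ {o h o′ h′} {𝒞 : Category o h} {𝒟 : Category o′ h′} →
           Functor 𝒞 𝒟 → Set (o ⊔ˡ h ⊔ˡ h′)
Faithful {𝒞 = 𝒞} F = ∀ {A B} (f g : Hom A B) → F₁ f ≡ F₁ g → f ≡ g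
  where
  open Category 𝒞
  open Functor F

idF : ∀ {o h} {𝒞 : Category o h} → Functor 𝒞 𝒞
idF = record
  { F₀ = λ A → A ; F₁ = λ f → f ; F-id = refl ; F-comp = λ _ _ → refl }

_∘F_ : ∀ {o h o′ h′ o″ h″} {𝒞 : Category o h} {𝒟 : Category o′ h′}
       {ℰ : Category o″ h″} → Functor 𝒟 ℰ → Functor 𝒞 𝒟 → Functor 𝒞 ℰ
G ∘F F = record
  { F₀     = λ A → G.F₀ (F.F₀ A)
  ; F₁     = λ f → G.F₁ (F.F₁ f)
  ; F-id   = trans (cong G.F₁ F.F-id) G.F-id
  ; F-comp = λ g f → trans (cong G.F₁ (F.F-comp g f)) (G.F-comp _ _)
  }
  where
  module F = Functor F
  module G = Functor G

record NatTrans {o h o′ h′} {𝒞 : Category o h} {𝒟 : Category o′ h′}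
       (F G : Functor 𝒞 𝒟) : Set (o ⊔ˡ h ⊔ˡ h′) where
  private
    module C = Category 𝒞
    module D = Category 𝒟
    module F = Functor F
    module G = Functor G
  field
    at      : ∀ A → D.Hom (F.F₀ A) (G.F₀ A)
    natural : ∀ {A B} (f : C.Hom A B) → at B D.∘ F.F₁ f ≡ G.F₁ f D.∘ at A

record NatIso {o h o′ h′} {𝒞 : Category o h} {𝒟 : Category o′ h′}
       (F G : Functor 𝒞 𝒟) : Set (o ⊔ˡ h ⊔ˡ h′) where
  field
    natTrans : NatTrans F G
    isIso    : ∀ A → Category.IsIso 𝒟 (NatTrans.at natTrans A)

record Equivalence {o h o′ h′} (𝒞 : Category o h) (𝒟 : Category o′ h′)
       : Set (o ⊔ˡ h ⊔ˡ o′ ⊔ˡ h′) where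
  field
    to     : Functor 𝒞 𝒟
    from   : Functor 𝒟 𝒞
    unit   : NatIso (from ∘F to) idF
    counit : NatIso (to ∘F from) idF

------------------------------------------------------------------------
-- Limits and exponentials, by universal property

module _ {o h} (𝒞 : Category o h) where
  open Category 𝒞

  record Product {i} {I : Set i} (X : I → Obj) : Set (o ⊔ˡ h ⊔ˡ i) where
    field
      ∏      : Obj
      π      : ∀ i → Hom ∏ (X i)
      ⟨_⟩    : ∀ {W} → (∀ i → Hom W (X i)) → Hom W ∏
      π-⟨⟩   : ∀ {W} (f : ∀ i → Hom W (X i)) i → π i ∘ ⟨ f ⟩ ≡ f i
      unique : ∀ {W} (f : ∀ i → Hom W (X i)) (u : Hom W ∏) →
               (∀ i → π i ∘ u ≡ f i) → u ≡ ⟨ f ⟩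

  productMap : ∀ {i} {I : Set i} {X Y : I → Obj} →
               (P : Product X) (Q : Product Y) → (∀ i → Hom (X i) (Y i)) →
               Hom (Product.∏ P) (Product.∏ Q)
  productMap P Q g = Product.⟨ Q ⟩ (λ i → g i ∘ Product.π P i)

  record BinaryProduct (A B : Obj) : Set (o ⊔ˡ h) where
    field
      A×B    : Obj
      fst    : Hom A×B A
      snd    : Hom A×B B
      ⟨_,_⟩  : ∀ {W} → Hom W A → Hom W B → Hom W A×B
      fst-⟨⟩ : ∀ {W} (f : Hom W A) (g : Hom W B) → fst ∘ ⟨ f , g ⟩ ≡ f
      snd-⟨⟩ : ∀ {W} (f : Hom W A) (g : Hom W B) → snd ∘ ⟨ f , g ⟩ ≡ g
      unique : ∀ {W} (f : Hom W A) (g : Hom W B) (u : Hom W A×B) →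
               fst ∘ u ≡ f → snd ∘ u ≡ g → u ≡ ⟨ f , g ⟩

  -- u × id_Z
  _×id : ∀ {A B Z} {P : BinaryProduct A Z} {Q : BinaryProduct B Z} →
         Hom A B → Hom (BinaryProduct.A×B P) (BinaryProduct.A×B Q)
  _×id {P = P} {Q} u = BinaryProduct.⟨_,_⟩ Q (u ∘ BinaryProduct.fst P) (BinaryProduct.snd P)

  -- The exponential X^Z.
  record Exponential (X Z : Obj) : Set (o ⊔ˡ h) where
    field
      X^Z    : Obj
      X^Z×Z  : BinaryProduct X^Z Z
      eval   : Hom (BinaryProduct.A×B X^Z×Z) X
      curry  : ∀ {W} (W×Z : BinaryProduct W Z) →
               Hom (BinaryProduct.A×B W×Z) X → Hom W X^Z
      β      : ∀ {W} (W×Z : BinaryProduct W Z) (f : Hom (BinaryProduct.A×B W×Z) X) →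
               eval ∘ _×id {P = W×Z} {X^Z×Z} (curry W×Z f) ≡ f
      unique : ∀ {W} (W×Z : BinaryProduct W Z) (f : Hom (BinaryProduct.A×B W×Z) X)
               (u : Hom W X^Z) →
               eval ∘ _×id {P = W×Z} {X^Z×Z} u ≡ f → u ≡ curry W×Z f

  -- g^Z : X^Z → Y^Z
  exponentialMap : ∀ {X Y Z} (E : Exponential X Z) (E′ : Exponential Y Z) → Hom X Y →
                   Hom (Exponential.X^Z E) (Exponential.X^Z E′)
  exponentialMap E E′ g =
    Exponential.curry E′ (Exponential.X^Z×Z E) (g ∘ Exponential.eval E)

  -- The limit of ⋯ → X 2 → X 1 → X 0.
  record SequentialLimit (X : ℕ → Obj) (p : ∀ n → Hom (X (suc n)) (X n))
         : Set (o ⊔ˡ h) where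
    field
      lim    : Obj
      π      : ∀ n → Hom lim (X n)
      cone   : ∀ n → p n ∘ π (suc n) ≡ π n
      ⟨_⟩    : ∀ {W} (f : ∀ n → Hom W (X n)) → (∀ n → p n ∘ f (suc n) ≡ f n) → Hom W lim
      π-⟨⟩   : ∀ {W} (f : ∀ n → Hom W (X n)) (c : ∀ n → p n ∘ f (suc n) ≡ f n) n →
               π n ∘ ⟨ f ⟩ c ≡ f n
      unique : ∀ {W} (f : ∀ n → Hom W (X n)) (c : ∀ n → p n ∘ f (suc n) ≡ f n)
               (u : Hom W lim) → (∀ n → π n ∘ u ≡ f n) → u ≡ ⟨ f ⟩ c

------------------------------------------------------------------------
-- Internal choice principles of a topos.  Limits and exponentials are
-- determined up to isomorphism, so each principle speaks about any choice of
-- them; in a topos they always exist.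

  CountableChoice : Set (o ⊔ˡ h)
  CountableChoice =
    (X Y : ℕ → Obj) (g : ∀ i → Hom (X i) (Y i)) → (∀ i → Epi (g i)) →
    (∏X : Product X) (∏Y : Product Y) → Epi (productMap ∏X ∏Y g)

  DependentChoice : Set (o ⊔ˡ h)
  DependentChoice =
    (X : ℕ → Obj) (p : ∀ n → Hom (X (suc n)) (X n)) → (∀ n → Epi (p n)) →
    (L : SequentialLimit X p) → Epi (SequentialLimit.π L zero)

  InternalChoice : Set (o ⊔ˡ h)
  InternalChoice =
    (X Y : Obj) (g : Hom X Y) → Epi g →
    (Z : Obj) (X^Z : Exponential X Z) (Y^Z : Exponential Y Z) →
    Epi (exponentialMap X^Z Y^Z g)

------------------------------------------------------------------------
-- Sheaves

Presheaf : ∀ {o h} → Category o h → Set (o ⊔ˡ lsuc h)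
Presheaf {h = h} 𝒟 = Functor (op 𝒟) (Sets h)

module _ {o h} (𝒟 : Category o h) where
  open Category 𝒟

  record Family (U : Obj) : Set (o ⊔ˡ lsuc h) where
    field
      Index : Set h
      dom   : Index → Obj
      map   : ∀ i → Hom (dom i) U

  -- A Grothendieck topology, given by its covering families.
  Coverage : Set (o ⊔ˡ lsuc h)
  Coverage = ∀ {U} → Family U → Set h

  atomic : Coverage
  atomic 𝓕 = Family.Index 𝓕

  module _ (P : Presheaf 𝒟) where
    open Functor P

    Matching : ∀ {U} (𝓕 : Family U) → (∀ i → F₀ (Family.dom 𝓕 i)) → Set (o ⊔ˡ h)
    Matching 𝓕 s =
      ∀ i j {W} (g : Hom W (dom i)) (k : Hom W (dom j)) →
      map i ∘ g ≡ map j ∘ k → F₁ g (s i) ≡ F₁ k (s j)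
      where open Family 𝓕

    IsSheaf : Coverage → Set (o ⊔ˡ lsuc h)
    IsSheaf J =
      ∀ {U} (𝓕 : Family U) → J 𝓕 →
      (s : ∀ i → F₀ (Family.dom 𝓕 i)) → Matching 𝓕 s →
      ∃! _≡_ λ (x : F₀ U) → ∀ i → F₁ (Family.map 𝓕 i) x ≡ s i

  record Sheaf (J : Coverage) : Set (o ⊔ˡ lsuc h) where
    field
      presheaf : Presheaf 𝒟
      isSheaf  : IsSheaf presheaf J

module _ (ext : FunExt) {o h} (𝒟 : Category o h) where
  open Category 𝒟

  representable : Obj → Presheaf 𝒟
  representable A = record
    { F₀     = λ U → Hom U A
    ; F₁     = λ f x → x ∘ f
    ; F-id   = ext idʳ
    ; F-comp = λ g f → ext λ x → sym (assoc g f x)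
    }

  Subcanonical : Coverage 𝒟 → Set (o ⊔ˡ lsuc h)
  Subcanonical J = ∀ A → IsSheaf 𝒟 (representable A) J

module _ (ext : FunExt) where

  NatTrans-≡ : ∀ {o h o′ h′} {𝒞 : Category o h} {𝒟 : Category o′ h′}
               {F G : Functor 𝒞 𝒟} {α β : NatTrans F G} →
               (∀ A → NatTrans.at α A ≡ NatTrans.at β A) → α ≡ β
  NatTrans-≡ {𝒞 = 𝒞} {𝒟} {F} {G} {α} {β} e = go (ext e)
    where
    module C = Category 𝒞
    module D = Category 𝒟
    module F = Functor F
    module G = Functor G

    Natural : (∀ A → D.Hom (F.F₀ A) (G.F₀ A)) → Set _
    Natural t = ∀ A B (f : C.Hom A B) → t B D.∘ F.F₁ f ≡ G.F₁ f D.∘ t A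

    mk : (t : ∀ A → D.Hom (F.F₀ A) (G.F₀ A)) → Natural t → NatTrans F G
    mk t n = record { at = t ; natural = λ {A} {B} → n A B }

    go′ : ∀ {t t′} → t ≡ t′ → (n : Natural t) (n′ : Natural t′) → mk t n ≡ mk t′ n′
    go′ refl n n′ = cong (mk _) (ext λ A → ext λ B → ext λ f → uip (n A B f) (n′ A B f))

    go : NatTrans.at α ≡ NatTrans.at β → α ≡ β
    go p = go′ p (λ _ _ → NatTrans.natural α) (λ _ _ → NatTrans.natural β)

  Sh : ∀ {o h} (𝒟 : Category o h) → Coverage 𝒟 → Category (o ⊔ˡ lsuc h) (o ⊔ˡ h)
  Sh 𝒟 J = record
    { Obj   = Sheaf 𝒟 J
    ; Hom   = λ P Q → NatTrans (Sheaf.presheaf P) (Sheaf.presheaf Q)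
    ; idm   = record { at = λ _ x → x ; natural = λ _ → refl }
    ; _∘_   = λ β α → record
      { at      = λ A x → NatTrans.at β A (NatTrans.at α A x)
      ; natural = λ {A} {B} f → trans
          (cong (λ k x → NatTrans.at β B (k x)) (NatTrans.natural α f))
          (cong (λ k x → k (NatTrans.at α A x)) (NatTrans.natural β f))
      }
    ; idˡ   = λ _ → NatTrans-≡ λ _ → refl
    ; idʳ   = λ _ → NatTrans-≡ λ _ → refl
    ; assoc = λ _ _ _ → NatTrans-≡ λ _ → refl
    }

------------------------------------------------------------------------
-- Structure-classes

record StructureClass (ℓ : Level) : Set (lsuc (lsuc ℓ)) where
  field
    category   : Category (lsuc ℓ) ℓ
    underlying : Functor category (Sets ℓ)

  open Category category public
  open Functor underlying public
    renaming (F₀ to ∣_∣; F₁ to ∣_∣₁; F-id to ∣∣-id; F-comp to ∣∣-comp)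

  field
    faithful  : Faithful underlying
    injective : ∀ {A B} (f : Hom A B) → Injective _≡_ _≡_ ∣ f ∣₁
    reflects  : ∀ {A B} (f : Hom A B) → Bijective _≡_ _≡_ ∣ f ∣₁ → IsIso f

    -- The equation ∣ σ̄ ∣ = σ is stated after moving the codomain of ∣ σ̄ ∣
    -- along p : ∣ Aσ ∣ = X.
    transport : ∀ A {X : Set ℓ} (σ : ∣ A ∣ → X) → Bijective _≡_ _≡_ σ →
                Σ Obj λ Aσ → Σ (∣ Aσ ∣ ≡ X) λ p → Σ (Hom A Aσ) λ σ̄ →
                IsIso σ̄ × subst (λ Y → ∣ A ∣ → Y) p ∣ σ̄ ∣₁ ≡ σ

    -- Obj lives in Set (lsuc ℓ), i.e. it may be a proper class; "form a set"
    -- means being in bijection with an element of Set ℓ.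
    fibre     : (X : Set ℓ) → Σ (Set ℓ) λ S → S ↔ Σ Obj λ A → ∣ A ∣ ≡ X

Finite : ∀ {ℓ} → Set ℓ → Set ℓ
Finite X = ∃ λ n → X ↔ Fin n

card : ∀ {ℓ} {X : Set ℓ} → Finite X → ℕ
card = proj₁

module _ {ℓ} (𝒦 : StructureClass ℓ) where
  open StructureClass 𝒦

  FiniteStructures : Set (lsuc ℓ)
  FiniteStructures = ∀ A → Finite ∣ A ∣

  Amalgamation : Set (lsuc ℓ)
  Amalgamation = ∀ {A B C} (f : Hom A B) (g : Hom A C) →
    Σ Obj λ D → Σ (Hom B D) λ h → Σ (Hom C D) λ k → h ∘ f ≡ k ∘ g

  Coherence : Set (lsuc ℓ)
  Coherence = ∀ {A B C} (g : Hom A C) (h : Hom B C) (f : ∣ A ∣ → ∣ B ∣) →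
    ∣ g ∣₁ ≡ (λ x → ∣ h ∣₁ (f x)) → Σ (Hom A B) λ f̄ → ∣ f̄ ∣₁ ≡ f

  record SubcanonicalAPClass (ext : FunExt) : Set (lsuc ℓ) where
    field
      coherence    : Coherence
      amalgamation : Amalgamation
      subcanonical : Subcanonical ext (op category) (atomic (op category))

  SameComponent : Obj → Obj → Set (lsuc ℓ)
  SameComponent = EqClosure Hom

  -- A connected component is given by one of its members A₀.
  BoundedOnComponents : FiniteStructures → Set (lsuc ℓ)
  BoundedOnComponents fin =
    ∀ A₀ → Σ ℕ λ b → ∀ A → SameComponent A₀ A → card (fin A) ≤ b

------------------------------------------------------------------------
-- A structure-class of finite structures is essentially small, so that small
-- categories equivalent to it exist.

module EssentiallySmall {ℓ} (𝒦 : StructureClass ℓ) (fin : FiniteStructures 𝒦) where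
  open StructureClass 𝒦

  Code : Set ℓ
  Code = Σ ℕ λ n → proj₁ (fibre (Lift ℓ (Fin n)))

  decode : Code → Obj
  decode (n , s) = proj₁ (Inverse.to (proj₂ (fibre (Lift ℓ (Fin n)))) s)

  small : Category ℓ ℓ
  small = record
    { Obj   = Code
    ; Hom   = λ c d → Hom (decode c) (decode d)
    ; idm   = idm
    ; _∘_   = _∘_
    ; idˡ   = idˡ
    ; idʳ   = idʳ
    ; assoc = assoc
    }

  Represents : Obj → Set ℓ
  Represents A = Σ Code λ c → Σ (Hom (decode c) A) IsIso

  represent : ∀ A → Represents A
  represent A with transport A σ (σ-injective , σ-surjective)
    where
    open Inverse (proj₂ (fin A)) renaming (to to to′; from to from′)

    σ : ∣ A ∣ → Lift ℓ (Fin (card (fin A)))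
    σ x = lift (to′ x)

    σ-injective : Injective _≡_ _≡_ σ
    σ-injective {x} {y} e = trans (sym (strictlyInverseʳ x))
      (trans (cong (λ z → from′ (lower z)) e) (strictlyInverseʳ y))

    σ-surjective : Surjective _≡_ _≡_ σ
    σ-surjective (lift i) = from′ i , λ { refl → cong lift (strictlyInverseˡ i) }
  ... | Aσ , p , σ̄ , iso , _ =
    (card (fin A) , Inverse.from S↔ (Aσ , p)) ,
    subst (λ B → Σ (Hom B A) IsIso)
      (sym (cong proj₁ (Inverse.strictlyInverseˡ S↔ (Aσ , p))))
      (IsIso.inv iso , record { inv = σ̄ ; invˡ = IsIso.invʳ iso ; invʳ = IsIso.invˡ iso })
    where S↔ = proj₂ (fibre (Lift ℓ (Fin (card (fin A)))))

  private
    e : ∀ A → Hom (decode (proj₁ (represent A))) A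
    e A = proj₁ (proj₂ (represent A))

    module e {A} = IsIso (proj₂ (proj₂ (represent A)))

    -- e⁻¹ ∘ f ∘ e
    conj : ∀ {A B} → Hom A B →
           Hom (decode (proj₁ (represent A))) (decode (proj₁ (represent B)))
    conj f = e.inv ∘ f ∘ e _

    cancel : ∀ {A W} (u : Hom W A) → e A ∘ e.inv ∘ u ≡ u
    cancel u = trans (sym (assoc _ _ _)) (trans (cong (_∘ u) e.invʳ) (idˡ u))

    conj-comp : ∀ {A B C} (g : Hom B C) (f : Hom A B) → conj (g ∘ f) ≡ conj g ∘ conj f
    conj-comp g f = begin
      e.inv ∘ (g ∘ f) ∘ e _                   ≡⟨ cong (e.inv ∘_) (assoc _ _ _) ⟩
      e.inv ∘ g ∘ f ∘ e _                     ≡⟨ cong (λ u → e.inv ∘ g ∘ u) (cancel _) ⟨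
      e.inv ∘ g ∘ e _ ∘ e.inv ∘ f ∘ e _       ≡⟨ cong (e.inv ∘_) (assoc _ _ _) ⟨
      e.inv ∘ (g ∘ e _) ∘ e.inv ∘ f ∘ e _     ≡⟨ assoc _ _ _ ⟨
      (e.inv ∘ g ∘ e _) ∘ (e.inv ∘ f ∘ e _)   ∎
      where open ≡-Reasoning

  equivalence : Equivalence small category
  equivalence = record
    { to     = record { F₀ = decode ; F₁ = λ f → f ; F-id = refl ; F-comp = λ _ _ → refl }
    ; from   = record
      { F₀     = λ A → proj₁ (represent A)
      ; F₁     = conj
      ; F-id   = trans (cong (e.inv ∘_) (idˡ _)) e.invˡ
      ; F-comp = conj-comp
      }
    ; unit   = record
      { natTrans = record { at = λ c → e (decode c) ; natural = λ f → cancel _ }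
      ; isIso    = λ c → record { inv = e.inv ; invˡ = e.invˡ ; invʳ = e.invʳ }
      }
    ; counit = record
      { natTrans = record { at = e ; natural = λ f → cancel _ }
      ; isIso    = λ A → proj₂ (proj₂ (represent A))
      }
    }

{-# OPTIONS --safe #-}
module Submission where

-- A sheaf on 𝒦ᵒᵖ is a covariant functor P on 𝒦, and a map of sheaves is epi iff it is
-- locally surjective.
--
-- If sizes are bounded, every object embeds into a maximal one, that is, an object V all
-- of whose outgoing embeddings are isomorphisms.  Epimorphisms are surjective at maximal
-- objects, and sheaves are determined by their values there, so all the choice principles
-- follow from choice in Set.
--
-- If sizes above U are unbounded, amalgamation yields a chain U = D 0 → D 1 → ⋯ with
-- ∣D n∣ ≥ n.  The maps Hom(D n , -) → Hom(U , -) are epimorphisms of sheaves, and each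
-- choice principle would provide a single V receiving embeddings from all D n, which is
-- impossible as V is finite.

open import Defs
open import Axiom.ExcludedMiddle using (ExcludedMiddle)
open import Data.Bool.Base using (Bool; true)
open import Data.Empty using (⊥; ⊥-elim)
open import Data.Fin.Base using (Fin; punchOut)
open import Data.Fin.Properties using (_≟_; any?; injective⇒≤; punchOut-injective)
open import Data.Nat.Base using (ℕ; zero; suc; _+_; _≤_; _<_; z≤n; s≤s)
open import Data.Nat.Properties
  using (≤-reflexive; ≤-trans; <-≤-trans; ≮⇒≥; <⇒≱; 1+n≰n; m≤m+n; +-suc; +-monoʳ-≤)
open import Data.Product.Base using (_×_; Σ; _,_; proj₁; proj₂)
open import Data.Product.Properties.WithK using (,-injectiveʳ)
open import Data.Unit.Base using (⊤; tt)
open import Function.Bundles using (_⇔_; Inverse; mk⇔)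
open import Function.Definitions using (Injective; Surjective)
open import Level using (Level; Lift; lift; lower)
open import Relation.Binary.Construct.Closure.ReflexiveTransitive using (ε; _◅_)
open import Relation.Binary.Construct.Closure.Symmetric using (fwd; bwd)
open import Relation.Binary.PropositionalEquality
  using (_≡_; refl; sym; trans; cong; cong₂; cong-app; subst; module ≡-Reasoning)
open import Relation.Nullary using (Dec; does; yes; no; ¬_)
open import Relation.Nullary.Decidable using (does-⇔; dec-true)

-- Categories

module _ {o h} (𝒞 : Category o h) where
  open Category 𝒞

  HasAmalgamation : Set _
  HasAmalgamation = ∀ {A B C} (f : Hom A B) (g : Hom A C) →
    Σ Obj λ D → Σ (Hom B D) λ h → Σ (Hom C D) λ k → h ∘ f ≡ k ∘ g

  AllMono : Set _
  AllMono = ∀ {A U V} (f : Hom U V) (x y : Hom A U) → f ∘ x ≡ f ∘ y → x ≡ y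

  -- The existence half of the sheaf condition for representables on one-member covers. Together
  -- with `AllMono` it makes every morphism a strict monomorphism.
  AllStrict : Set _
  AllStrict = ∀ {A U V} (f : Hom U V) (s : Hom A V) →
    (∀ {W} (g k : Hom V W) → g ∘ f ≡ k ∘ f → g ∘ s ≡ k ∘ s) →
    Σ (Hom A U) λ x → f ∘ x ≡ s

  iso-cancelʳ : ∀ {A B C} {e : Hom A B} → IsIso e →
                {f g : Hom B C} → f ∘ e ≡ g ∘ e → f ≡ g
  iso-cancelʳ {e = e} iso {f} {g} fe≡ge = begin
    f               ≡⟨ idʳ f ⟨
    f ∘ idm         ≡⟨ cong (f ∘_) invʳ ⟨
    f ∘ e ∘ inv     ≡⟨ assoc _ _ _ ⟨
    (f ∘ e) ∘ inv   ≡⟨ cong (_∘ inv) fe≡ge ⟩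
    (g ∘ e) ∘ inv   ≡⟨ assoc _ _ _ ⟩
    g ∘ e ∘ inv     ≡⟨ cong (g ∘_) invʳ ⟩
    g ∘ idm         ≡⟨ idʳ g ⟩
    g               ∎
    where
    open ≡-Reasoning
    open IsIso iso

  naturallyIdentity⇒faithful : ∀ {F : Functor 𝒞 𝒞} → NatIso F idF → Faithful F
  naturallyIdentity⇒faithful α f g Ff≡Fg = iso-cancelʳ (NatIso.isIso α _)
    (trans (sym (natural f)) (trans (cong (at _ ∘_) Ff≡Fg) (natural g)))
    where open NatTrans (NatIso.natTrans α)

  -- Covers are taken in `op 𝒞`, so a cover of `U` consists of morphisms out of `U`.
  singleton : ∀ {U V} → Hom U V → Family (op 𝒞) U
  singleton {V = V} f = record { Index = Lift h ⊤ ; dom = λ _ → V ; map = λ _ → f }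

  Maximal : Obj → Set _
  Maximal V = ∀ {W} (f : Hom V W) → IsIso f

  ×id-∘ : ∀ {A B C Z} (P : BinaryProduct 𝒞 A Z) (Q : BinaryProduct 𝒞 B Z)
          (R : BinaryProduct 𝒞 C Z) (v : Hom B C) (u : Hom A B) →
          _×id 𝒞 {P = P} {R} (v ∘ u) ≡ _×id 𝒞 {P = Q} {R} v ∘ _×id 𝒞 {P = P} {Q} u
  ×id-∘ P Q R v u = sym (R.unique _ _ _
    (begin
      R.fst ∘ v×id ∘ u×id       ≡⟨ assoc _ _ _ ⟨
      (R.fst ∘ v×id) ∘ u×id     ≡⟨ cong (_∘ u×id) (R.fst-⟨⟩ _ _) ⟩
      (v ∘ Q.fst) ∘ u×id        ≡⟨ assoc _ _ _ ⟩
      v ∘ Q.fst ∘ u×id          ≡⟨ cong (v ∘_) (Q.fst-⟨⟩ _ _) ⟩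
      v ∘ u ∘ P.fst             ≡⟨ assoc _ _ _ ⟨
      (v ∘ u) ∘ P.fst           ∎)
    (begin
      R.snd ∘ v×id ∘ u×id       ≡⟨ assoc _ _ _ ⟨
      (R.snd ∘ v×id) ∘ u×id     ≡⟨ cong (_∘ u×id) (R.snd-⟨⟩ _ _) ⟩
      Q.snd ∘ u×id              ≡⟨ Q.snd-⟨⟩ _ _ ⟩
      P.snd                     ∎))
    where
    open ≡-Reasoning
    module P = BinaryProduct P
    module Q = BinaryProduct Q
    module R = BinaryProduct R
    v×id = _×id 𝒞 {P = Q} {R} v
    u×id = _×id 𝒞 {P = P} {Q} u

  -- By uniqueness of transposes, it suffices to compare the two sides after evaluation.
  exponentialMap-curry : ∀ {X Y Z W} (E : Exponential 𝒞 X Z) (E′ : Exponential 𝒞 Y Z)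
    (g : Hom X Y) (P : BinaryProduct 𝒞 W Z) (f : Hom (BinaryProduct.A×B P) X) →
    exponentialMap 𝒞 E E′ g ∘ Exponential.curry E P f ≡ Exponential.curry E′ P (g ∘ f)
  exponentialMap-curry E E′ g P f = E′.unique P (g ∘ f) _ (begin
    E′.eval ∘ ((gᶻ ∘ E.curry P f) ×id′)
      ≡⟨ cong (E′.eval ∘_) (×id-∘ P E.X^Z×Z E′.X^Z×Z gᶻ _) ⟩
    E′.eval ∘ _×id 𝒞 {P = E.X^Z×Z} {E′.X^Z×Z} gᶻ ∘ curry×id
      ≡⟨ assoc _ _ _ ⟨
    (E′.eval ∘ _×id 𝒞 {P = E.X^Z×Z} {E′.X^Z×Z} gᶻ) ∘ curry×id
      ≡⟨ cong (_∘ curry×id) (E′.β E.X^Z×Z _) ⟩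
    (g ∘ E.eval) ∘ curry×id
      ≡⟨ assoc _ _ _ ⟩
    g ∘ E.eval ∘ curry×id
      ≡⟨ cong (g ∘_) (E.β P f) ⟩
    g ∘ f ∎)
    where
    open ≡-Reasoning
    module E = Exponential E
    module E′ = Exponential E′
    gᶻ = exponentialMap 𝒞 E E′ g
    _×id′ = _×id 𝒞 {P = P} {E′.X^Z×Z}
    curry×id = _×id 𝒞 {P = P} {E.X^Z×Z} (E.curry P f)

-- Sheaves for the atomic topology

module AtomicSheaves (ext : FunExt) {ℓ : Level} (𝒞 : Category ℓ ℓ)
                     (amalgamate : HasAmalgamation 𝒞) where
  open Category 𝒞

  𝒮 : Category _ _
  𝒮 = Sh ext (op 𝒞) (atomic (op 𝒞))

  open Category 𝒮 using () renaming (Obj to ShObj; Hom to _⇒_; _∘_ to _∙_; Epi to ShEpi)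

  infix 30 _⟨_⟩

  _⟨_⟩ : ShObj → Obj → Set ℓ
  P ⟨ U ⟩ = Functor.F₀ (Sheaf.presheaf P) U

  act : (P : ShObj) → ∀ {U V} → Hom U V → P ⟨ U ⟩ → P ⟨ V ⟩
  act P f = Functor.F₁ (Sheaf.presheaf P) f

  act-id : (P : ShObj) → ∀ {U} (x : P ⟨ U ⟩) → act P idm x ≡ x
  act-id P = cong-app (Functor.F-id (Sheaf.presheaf P))

  act-∘ : (P : ShObj) → ∀ {U V W} (g : Hom V W) (f : Hom U V) (x : P ⟨ U ⟩) →
          act P (g ∘ f) x ≡ act P g (act P f x)
  act-∘ P g f = cong-app (Functor.F-comp (Sheaf.presheaf P) g f)

  act-square : (P : ShObj) → ∀ {U V V′ W} {g : Hom V W} {f : Hom U V}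
               {g′ : Hom V′ W} {f′ : Hom U V′} → g ∘ f ≡ g′ ∘ f′ → (x : P ⟨ U ⟩) →
               act P g (act P f x) ≡ act P g′ (act P f′ x)
  act-square P e x =
    trans (sym (act-∘ P _ _ x)) (trans (cong (λ k → act P k x) e) (act-∘ P _ _ x))

  -- Stated for presheaves: the sheaf P cannot be inferred from its underlying presheaf.
  module _ {P Q : Presheaf (op 𝒞)} where
    private
      module P = Functor P
      module Q = Functor Q

    _$_ : NatTrans P Q → ∀ {U} → P.F₀ U → Q.F₀ U
    α $ x = NatTrans.at α _ x

    naturality : (α : NatTrans P Q) → ∀ {U V} (f : Hom U V) (x : P.F₀ U) →
                 α $ P.F₁ f x ≡ Q.F₁ f (α $ x)
    naturality α f = cong-app (NatTrans.natural α f)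

    ⇒-≡ : {α β : NatTrans P Q} → (∀ {U} (x : P.F₀ U) → α $ x ≡ β $ x) → α ≡ β
    ⇒-≡ e = NatTrans-≡ ext λ _ → ext e

    $-cong : {α β : NatTrans P Q} → α ≡ β → ∀ {U} (x : P.F₀ U) → α $ x ≡ β $ x
    $-cong e x = cong (λ γ → γ $ x) e

  module _ (P : Presheaf (op 𝒞)) where
    open Functor P

    Separated : Set _
    Separated = ∀ {U V} (f : Hom U V) {x y : F₀ U} → F₁ f x ≡ F₁ f y → x ≡ y

    Descends : ∀ {U V} → Hom U V → F₀ V → Set _
    Descends {V = V} f s = ∀ {W} (g k : Hom V W) → g ∘ f ≡ k ∘ f → F₁ g s ≡ F₁ k s

    Glues : Set _
    Glues = ∀ {U V} (f : Hom U V) (s : F₀ V) → Descends f s → Σ (F₀ U) λ x → F₁ f x ≡ s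

    -- By amalgamation, gluing along one member of a covering family suffices.
    isSheaf : Separated → Glues → IsSheaf (op 𝒞) P (atomic (op 𝒞))
    isSheaf separated glue 𝓕 i s matching with glue (map i) (s i) (matching i i)
      where open Family 𝓕
    ... | x , e = x , agrees , λ e′ → separated (map i) (trans (agrees i) (sym (e′ i)))
      where
      open Family 𝓕
      agrees : ∀ j → F₁ (map j) x ≡ s j
      agrees j with amalgamate (map j) (map i)
      ... | D , h , k , hj≡ki = separated h (begin
        F₁ h (F₁ (map j) x)   ≡⟨ cong-app (F-comp h (map j)) x ⟨
        F₁ (h ∘ map j) x      ≡⟨ cong (λ f → F₁ f x) hj≡ki ⟩
        F₁ (k ∘ map i) x      ≡⟨ cong-app (F-comp k (map i)) x ⟩
        F₁ k (F₁ (map i) x)   ≡⟨ cong (F₁ k) e ⟩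
        F₁ k (s i)            ≡⟨ matching j i h k hj≡ki ⟨
        F₁ h (s j)            ∎)
        where open ≡-Reasoning

  module _ (P : ShObj) where
    glue : Glues (Sheaf.presheaf P)
    glue f s d with Sheaf.isSheaf P (singleton 𝒞 f) (lift tt) (λ _ → s) (λ _ _ → d)
    ... | x , e , _ = x , e (lift tt)

    -- Both `x` and `y` glue the one-member family given by the restriction of `x`.
    separated : Separated (Sheaf.presheaf P)
    separated f {x} {y} e
      with Sheaf.isSheaf P (singleton 𝒞 f) (lift tt) (λ _ → act P f x)
             (λ _ _ g k gf≡kf → act-square P gf≡kf x)
    ... | _ , _ , unique = trans (sym (unique (λ _ → refl))) (unique (λ _ → sym e))

  -- Every nonempty family covers, so a lift after restriction along a single morphism is a local
  -- lift.
  LiftsLocally : ∀ X Y → X ⇒ Y → ∀ {U} → Y ⟨ U ⟩ → Set ℓ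
  LiftsLocally X Y g {U} y =
    Σ Obj λ V → Σ (Hom U V) λ f → Σ (X ⟨ V ⟩) λ x → g $ x ≡ act Y f y

  LocallySurjective : ∀ X Y → X ⇒ Y → Set ℓ
  LocallySurjective X Y g = ∀ {U} (y : Y ⟨ U ⟩) → LiftsLocally X Y g y

  -- `u` and `v` agree on the restriction of `y` that lifts along `g`, and `W` is separated.
  locallySurjective⇒epi : ∀ X Y (g : X ⇒ Y) → LocallySurjective X Y g → ShEpi {X} {Y} g
  locallySurjective⇒epi X Y g surj {W} u v ug≡vg = ⇒-≡ λ y → pointwise y (surj y)
    where
    pointwise : ∀ {U} (y : Y ⟨ U ⟩) → LiftsLocally X Y g y → u $ y ≡ v $ y
    pointwise y (V , f , x , gx≡fy) = separated W f (begin
      act W f (u $ y)   ≡⟨ naturality u f y ⟨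
      u $ act Y f y     ≡⟨ cong (u $_) gx≡fy ⟨
      u $ (g $ x)       ≡⟨ $-cong ug≡vg x ⟩
      v $ (g $ x)       ≡⟨ cong (v $_) gx≡fy ⟩
      v $ act Y f y     ≡⟨ naturality v f y ⟩
      act W f (v $ y)   ∎)
      where open ≡-Reasoning

  -- The constant presheaf is already a sheaf: restrictions are identities and covers are nonempty.
  constant : Set ℓ → ShObj
  constant S = record { presheaf = P ; isSheaf = isSheaf P (λ _ e → e) (λ _ s _ → s , refl) }
    where
    P : Presheaf (op 𝒞)
    P = record { F₀ = λ _ → S ; F₁ = λ _ s → s ; F-id = refl ; F-comp = λ _ _ → refl }

  -- By amalgamation, y has a local lift iff its restrictions do, so the image of g is a
  -- complemented subsheaf, classified by a map χ to the constant sheaf of booleans.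
  epi⇒locallySurjective : (∀ {a} → ExcludedMiddle a) →
                          ∀ X Y (g : X ⇒ Y) → ShEpi {X} {Y} g → LocallySurjective X Y g
  epi⇒locallySurjective em X Y g epi {U} y = lifts (em {P = Image y}) (sym ($-cong ⊤≡χ y))
    where
    Image : ∀ {U} → Y ⟨ U ⟩ → Set ℓ
    Image = LiftsLocally X Y g

    restrict : ∀ {U V} (f : Hom U V) (y : Y ⟨ U ⟩) → Image y → Image (act Y f y)
    restrict f y (V′ , f′ , x , e) with amalgamate f f′
    ... | D , h , k , hf≡kf′ = D , h , act X k x ,
      trans (naturality g k x) (trans (cong (act Y k) e) (sym (act-square Y hf≡kf′ y)))

    extend : ∀ {U V} (f : Hom U V) (y : Y ⟨ U ⟩) → Image (act Y f y) → Image y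
    extend f y (V , k , x , e) = V , k ∘ f , x , trans e (sym (act-∘ Y k f y))

    ⊤ᵐ χ : Y ⇒ constant (Lift ℓ Bool)
    ⊤ᵐ = record { at = λ _ _ → lift true ; natural = λ _ → refl }
    χ = record
      { at = λ _ y → lift (does (em {P = Image y}))
      ; natural = λ f → ext λ y → cong lift (does-⇔ (mk⇔ (extend f y) (restrict f y)) em em)
      }

    ⊤≡χ : ⊤ᵐ ≡ χ
    ⊤≡χ = epi {constant (Lift ℓ Bool)} ⊤ᵐ χ (⇒-≡ λ {V} x →
      cong lift (sym (dec-true em (V , idm , x , sym (act-id Y (g $ x))))))

    lifts : ∀ {A : Set ℓ} (a? : Dec A) → lift {ℓ = ℓ} (does a?) ≡ lift true → A
    lifts (yes a) _ = a

  -- Constructions of sheaves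

  -- The pointwise disjoint union is already a sheaf: restriction preserves the summand, so gluing
  -- takes place inside a single one.
  ∐ : {I : Set} → (I → ShObj) → ShObj
  ∐ {I} X = record { presheaf = P ; isSheaf = isSheaf P sep gl }
    where
    P : Presheaf (op 𝒞)
    P = record
      { F₀     = λ U → Σ I λ i → X i ⟨ U ⟩
      ; F₁     = λ f (i , x) → i , act (X i) f x
      ; F-id   = ext λ (i , x) → cong (i ,_) (act-id (X i) x)
      ; F-comp = λ g f → ext λ (i , x) → cong (i ,_) (act-∘ (X i) g f x)
      }

    sep : Separated P
    sep f {i , x} {j , y} e with cong proj₁ e
    ... | refl = cong (i ,_) (separated (X i) f (,-injectiveʳ e))

    gl : Glues P
    gl f (i , s) d with glue (X i) f s (λ g k e → ,-injectiveʳ (d g k e))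
    ... | x , e = (i , x) , cong (i ,_) e

  ∐-map : {I : Set} (X Y : I → ShObj) → (∀ i → X i ⇒ Y i) → ∐ X ⇒ ∐ Y
  ∐-map X Y g = record
    { at      = λ _ (i , x) → i , g i $ x
    ; natural = λ f → ext λ (i , x) → cong (i ,_) (naturality (g i) f x)
    }

  ∐-map-locallySurjective : {I : Set} (X Y : I → ShObj) (g : ∀ i → X i ⇒ Y i) →
    (∀ i → LocallySurjective (X i) (Y i) (g i)) → LocallySurjective (∐ X) (∐ Y) (∐-map X Y g)
  ∐-map-locallySurjective X Y g surj (i , y) with surj i y
  ... | V , f , x , e = V , f , (i , x) , cong (i ,_) e

  ∏ˢ : {I : Set} → (I → ShObj) → ShObj
  ∏ˢ {I} X = record { presheaf = P ; isSheaf = isSheaf P sep gl }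
    where
    P : Presheaf (op 𝒞)
    P = record
      { F₀     = λ U → ∀ i → X i ⟨ U ⟩
      ; F₁     = λ f x i → act (X i) f (x i)
      ; F-id   = ext λ x → ext λ i → act-id (X i) (x i)
      ; F-comp = λ g f → ext λ x → ext λ i → act-∘ (X i) g f (x i)
      }

    sep : Separated P
    sep f e = ext λ i → separated (X i) f (cong-app e i)

    gl : Glues P
    gl f s d = (λ i → proj₁ (descent i)) , ext λ i → proj₂ (descent i)
      where
      descent : ∀ i → Σ (X i ⟨ _ ⟩) λ x → act (X i) f x ≡ s i
      descent i = glue (X i) f (s i) λ g k e → cong-app (d g k e) i

  product : {I : Set} (X : I → ShObj) → Product 𝒮 X
  product X = record
    { ∏      = ∏ˢ X
    ; π      = λ i → record { at = λ _ x → x i ; natural = λ _ → refl }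
    ; ⟨_⟩    = λ f → record
      { at      = λ _ w i → f i $ w
      ; natural = λ h → ext λ w → ext λ i → naturality (f i) h w
      }
    ; π-⟨⟩   = λ f i → ⇒-≡ λ _ → refl
    ; unique = λ f u e → ⇒-≡ λ w → ext λ i → $-cong (e i) w
    }

  binaryProduct : (A B : ShObj) → BinaryProduct 𝒮 A B
  binaryProduct A B = record
    { A×B    = record { presheaf = P ; isSheaf = isSheaf P sep gl }
    ; fst    = record { at = λ _ → proj₁ ; natural = λ _ → refl }
    ; snd    = record { at = λ _ → proj₂ ; natural = λ _ → refl }
    ; ⟨_,_⟩  = λ f g → record
      { at      = λ _ w → f $ w , g $ w
      ; natural = λ h → ext λ w → cong₂ _,_ (naturality f h w) (naturality g h w)
      }
    ; fst-⟨⟩ = λ f g → ⇒-≡ λ _ → refl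
    ; snd-⟨⟩ = λ f g → ⇒-≡ λ _ → refl
    ; unique = λ f g u e e′ → ⇒-≡ λ w → cong₂ _,_ ($-cong e w) ($-cong e′ w)
    }
    where
    P : Presheaf (op 𝒞)
    P = record
      { F₀     = λ U → A ⟨ U ⟩ × B ⟨ U ⟩
      ; F₁     = λ f (a , b) → act A f a , act B f b
      ; F-id   = ext λ (a , b) → cong₂ _,_ (act-id A a) (act-id B b)
      ; F-comp = λ g f → ext λ (a , b) → cong₂ _,_ (act-∘ A g f a) (act-∘ B g f b)
      }

    sep : Separated P
    sep f e = cong₂ _,_ (separated A f (cong proj₁ e)) (separated B f (cong proj₂ e))

    gl : Glues P
    gl f (a , b) d with glue A f a (λ g k e → cong proj₁ (d g k e))
                      | glue B f b (λ g k e → cong proj₂ (d g k e))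
    ... | x , e | y , e′ = (x , y) , cong₂ _,_ e e′

  -- Representable sheaves, the Yoneda correspondence and countable powers

  module Representables (mono : AllMono 𝒞) (strict : AllStrict 𝒞) where

    よ : Obj → ShObj
    よ A = record
      { presheaf = representable ext (op 𝒞) A
      ; isSheaf  = isSheaf (representable ext (op 𝒞) A) (λ f e → mono f _ _ e) strict
      }

    precompose : ∀ {A B} → Hom A B → よ B ⇒ よ A
    precompose f = record { at = λ _ x → x ∘ f ; natural = λ g → ext λ x → assoc f x g }

    -- Amalgamating `f` with `y` yields both the morphism `k` along which `y` is restricted and the
    -- lift `h`.
    precompose-locallySurjective : ∀ {A B} (f : Hom A B) →
      LocallySurjective (よ B) (よ A) (precompose f)
    precompose-locallySurjective f y with amalgamate f y
    ... | D , h , k , hf≡ky = D , k , h , hf≡ky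

    -- The Yoneda correspondence. It turns elements into morphisms, to which the universal
    -- properties of arbitrarily given limits apply.
    element : ∀ P {U} → P ⟨ U ⟩ → よ U ⇒ P
    element P x = record
      { at      = λ _ f → act P f x
      ; natural = λ g → ext λ f → act-∘ P g f x
      }

    element-idm : ∀ P {U} (x : P ⟨ U ⟩) → element P x $ idm ≡ x
    element-idm P x = act-id P x

    element-natural : ∀ P Q (α : P ⇒ Q) {U} (x : P ⟨ U ⟩) →
                      _∙_ {よ U} {P} {Q} α (element P x) ≡ element Q (α $ x)
    element-natural P Q α x = ⇒-≡ λ f → naturality α f x

    -- The choice principles quantify over all choices of products, so elements of a product need
    -- not be literal pairs; pairing and its laws are recovered through Yoneda.
    module Pairing (A B : ShObj) (A×B : BinaryProduct 𝒮 A B) where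
      open BinaryProduct A×B renaming (A×B to C)

      pair : ∀ {U} → A ⟨ U ⟩ → B ⟨ U ⟩ → C ⟨ U ⟩
      pair {U} a b = ⟨_,_⟩ {よ U} (element A a) (element B b) $ idm

      fst-pair : ∀ {U} (a : A ⟨ U ⟩) (b : B ⟨ U ⟩) → fst $ pair a b ≡ a
      fst-pair {U} a b = trans ($-cong (fst-⟨⟩ {よ U} _ _) idm) (element-idm A a)

      snd-pair : ∀ {U} (a : A ⟨ U ⟩) (b : B ⟨ U ⟩) → snd $ pair a b ≡ b
      snd-pair {U} a b = trans ($-cong (snd-⟨⟩ {よ U} _ _) idm) (element-idm B b)

      pair-ext : ∀ {U} (p q : C ⟨ U ⟩) → fst $ p ≡ fst $ q → snd $ p ≡ snd $ q → p ≡ q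
      pair-ext {U} p q e e′ = begin
        p                                               ≡⟨ element-idm C p ⟨
        element C p $ idm                               ≡⟨ $-cong element-p≡ idm ⟩
        pair (fst $ q) (snd $ q)                        ≡⟨ $-cong element-q≡ idm ⟨
        element C q $ idm                               ≡⟨ element-idm C q ⟩
        q                                               ∎
        where
        open ≡-Reasoning
        element-p≡ : element C p ≡ ⟨_,_⟩ {よ U} (element A (fst $ q)) (element B (snd $ q))
        element-p≡ = unique {よ U} _ _ _
          (trans (element-natural C A fst p) (cong (element A) e))
          (trans (element-natural C B snd p) (cong (element B) e′))
        element-q≡ : element C q ≡ ⟨_,_⟩ {よ U} (element A (fst $ q)) (element B (snd $ q))
        element-q≡ = unique {よ U} _ _ _
          (element-natural C A fst q) (element-natural C B snd q)

      pair-η : ∀ {U} (p : C ⟨ U ⟩) → pair (fst $ p) (snd $ p) ≡ p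
      pair-η p = pair-ext _ p (fst-pair _ _) (snd-pair _ _)

    N : ShObj
    N = constant (Lift ℓ ℕ)

    -- A map from `W` times the constant sheaf `N` is a sequence of maps from `W`, so exponentiation
    -- by `N` is the countable power.
    power : (X : ShObj) → Exponential 𝒮 X N
    power X = record
      { X^Z    = Xᴺ
      ; X^Z×Z  = binaryProduct Xᴺ N
      ; eval   = eval
      ; curry  = λ {W} W×N f → curry W W×N f
      ; β      = λ {W} W×N f → ⇒-≡ λ p → cong (f $_) (Pairing.pair-η W N W×N p)
      ; unique = λ {W} W×N f u e → ⇒-≡ λ w → ext λ n → let open Pairing W N W×N in
          -- Rewriting `w` and `n` as projections of their pair lets `e` be evaluated at that pair.
          trans (cong₂ (λ v m → (u $ v) (lower m))
                  (sym (fst-pair w (lift n))) (sym (snd-pair w (lift n))))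
                ($-cong e (pair w (lift n)))
      }
      where
      Xᴺ : ShObj
      Xᴺ = ∏ˢ {ℕ} λ _ → X

      eval : BinaryProduct.A×B (binaryProduct Xᴺ N) ⇒ X
      eval = record { at = λ _ (x , n) → x (lower n) ; natural = λ _ → refl }

      curry : ∀ W (W×N : BinaryProduct 𝒮 W N) → BinaryProduct.A×B W×N ⇒ X → W ⇒ Xᴺ
      curry W W×N f = record
        { at      = λ _ w n → f $ pair w (lift n)
        ; natural = λ h → ext λ w → ext λ n → trans
            (cong (f $_) (pair-ext _ _
              (trans (fst-pair _ _)
                (sym (trans (naturality fst h _) (cong (act W h) (fst-pair w _)))))
              (trans (snd-pair _ _)
                (sym (trans (naturality snd h _) (snd-pair w _))))))
            (naturality f h (pair w (lift n)))
        }
        where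
        open Pairing W N W×N
        open BinaryProduct W×N using (fst; snd)

    power-map : ∀ X Y (g : X ⇒ Y) {U} (x : ℕ → X ⟨ U ⟩) n →
                (exponentialMap 𝒮 (power X) (power Y) g $ x) n ≡ g $ x n
    power-map X Y g x n = cong₂ (λ v m → g $ v (lower m))
      (fst-pair x (lift n)) (snd-pair x (lift n))
      where open Pairing _ N (Exponential.X^Z×Z (power X))

-- Choice principles and bounds on sizes

-- Only objects above `U` are bounded; with amalgamation and monotone sizes this bounds the whole
-- component, since any member of it embeds into an object above `U`.
Bounded : ∀ {o h} (𝒞 : Category o h) → (Category.Obj 𝒞 → ℕ) → Set _
Bounded 𝒞 size = ∀ U → Σ ℕ λ b → ∀ {V} → Hom U V → size V ≤ b
  where open Category 𝒞

module Choice (ext : FunExt) (em : ∀ {a} → ExcludedMiddle a)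
  {ℓ : Level} (𝒞 : Category ℓ ℓ)
  (amalgamate : HasAmalgamation 𝒞) (mono : AllMono 𝒞) (strict : AllStrict 𝒞)
  (size : Category.Obj 𝒞 → ℕ)
  (size-mono : ∀ {U V} → Category.Hom 𝒞 U V → size U ≤ size V)
  (size-iso : ∀ {U V} (f : Category.Hom 𝒞 U V) → size V ≤ size U → Category.IsIso 𝒞 f)
  where

  open Category 𝒞
  open AtomicSheaves ext 𝒞 amalgamate
  open Representables mono strict
  open Category 𝒮 using () renaming (Obj to ShObj; Hom to _⇒_; _∘_ to _∙_; Epi to ShEpi)

  -- Choice principles from bounded sizes

  module FromBounded (bounded : Bounded 𝒞 size) where

    AboveMaximal : Obj → Set ℓ
    AboveMaximal U = Σ Obj λ V → Hom U V × Maximal 𝒞 V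

    -- Move to a strictly larger object while there is one; the bound limits the number of moves.
    -- Where nothing larger lies above, `size-iso` makes every outgoing morphism invertible.
    maximal-above : ∀ U → AboveMaximal U
    maximal-above U with bounded U
    -- The first argument of `search` bounds how far sizes can still grow above the current object.
    ... | b , size≤b = search b U λ f → ≤-trans (size≤b f) (m≤m+n b (size U))
      where
      search : ∀ n U → (∀ {V} → Hom U V → size V ≤ n + size U) → AboveMaximal U
      search n U bound with em {P = Σ Obj λ V → Hom U V × size U < size V}
      search n U bound | no none =
        U , idm , λ f → size-iso f (≮⇒≥ λ U<W → none (_ , f , U<W))
      search zero U bound | yes (V , f , U<V) = ⊥-elim (<⇒≱ U<V (bound f))
      search (suc n) U bound | yes (V , f , U<V)
        -- The size grows by at least one, which pays for lowering `suc n` to `n`.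
        with search n V (λ g → ≤-trans (bound (g ∘ f))
               (≤-trans (≤-reflexive (sym (+-suc n (size U)))) (+-monoʳ-≤ n U<V)))
      ... | W , g , max = W , g ∘ f , max

    -- Every `x` restricts to a maximal object, and `Q` is separated.
    ⇒-≡-maximal : ∀ P Q {α β : P ⇒ Q} →
      (∀ {V} → Maximal 𝒞 V → (x : P ⟨ V ⟩) → α $ x ≡ β $ x) → α ≡ β
    ⇒-≡-maximal P Q {α} {β} e = ⇒-≡ λ {U} x → let V , f , max = maximal-above U in
      separated Q f (trans (sym (naturality α f x))
        (trans (e max (act P f x)) (naturality β f x)))

    surjective-maximal⇒epi : ∀ P Q (g : P ⇒ Q) →
      (∀ {V} → Maximal 𝒞 V → (y : Q ⟨ V ⟩) → Σ (P ⟨ V ⟩) λ x → g $ x ≡ y) → ShEpi {P} {Q} g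
    surjective-maximal⇒epi P Q g surj {W} u v ug≡vg = ⇒-≡-maximal Q W λ max y →
      let x , gx≡y = surj max y in
      trans (cong (u $_) (sym gx≡y)) (trans ($-cong ug≡vg x) (cong (v $_) gx≡y))

    -- A local lift lives along some `f` out of `V`; maximality inverts `f`, which carries the lift
    -- back to `V`.
    epi⇒surjective-maximal : ∀ P Q (g : P ⇒ Q) → ShEpi {P} {Q} g →
      ∀ {V} → Maximal 𝒞 V → (y : Q ⟨ V ⟩) → Σ (P ⟨ V ⟩) λ x → g $ x ≡ y
    epi⇒surjective-maximal P Q g epi max y with epi⇒locallySurjective em P Q g (λ {W} → epi {W}) y
    ... | W , f , x , gx≡fy = act P inv x , (begin
      g $ act P inv x           ≡⟨ naturality g inv x ⟩
      act Q inv (g $ x)         ≡⟨ cong (act Q inv) gx≡fy ⟩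
      act Q inv (act Q f y)     ≡⟨ act-∘ Q inv f y ⟨
      act Q (inv ∘ f) y         ≡⟨ cong (λ k → act Q k y) invˡ ⟩
      act Q idm y               ≡⟨ act-id Q y ⟩
      y                         ∎)
      where
      open ≡-Reasoning
      open IsIso (max f)

    -- At a maximal `V` preimages are chosen index by index. As the product is arbitrary, they are
    -- assembled into a map out of `よ V` and evaluated at the identity.
    countableChoice : CountableChoice 𝒮
    countableChoice X Y g epi ∏X ∏Y {W} = surjective-maximal⇒epi X.∏ Y.∏ ∏g lift-all {W}
      where
      open ≡-Reasoning
      module X = Product ∏X
      module Y = Product ∏Y

      ∏g : X.∏ ⇒ Y.∏
      ∏g = productMap 𝒮 ∏X ∏Y g

      lift-all : ∀ {V} → Maximal 𝒞 V → (y : Y.∏ ⟨ V ⟩) → Σ (X.∏ ⟨ V ⟩) λ x → ∏g $ x ≡ y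
      lift-all {V} max y = xs $ idm , trans ($-cong ∏g∙xs≡y idm) (element-idm Y.∏ y)
        where
        lifts : ∀ i → Σ (X i ⟨ V ⟩) λ x → g i $ x ≡ Y.π i $ y
        lifts i = epi⇒surjective-maximal (X i) (Y i) (g i) (λ {W} → epi i {W}) max (Y.π i $ y)

        xs : よ V ⇒ X.∏
        xs = X.⟨_⟩ {よ V} λ i → element (X i) (proj₁ (lifts i))

        ys : ∀ i → よ V ⇒ Y i
        ys i = element (Y i) (Y.π i $ y)

        ∏g∙xs≡y : _∙_ {よ V} {X.∏} {Y.∏} ∏g xs ≡ element Y.∏ y
        ∏g∙xs≡y = trans
          (Y.unique {よ V} ys _ λ i → ⇒-≡ λ h → begin
            Y.π i $ (∏g $ (xs $ h))
              ≡⟨ $-cong (Y.π-⟨⟩ {X.∏} _ i) (xs $ h) ⟩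
            g i $ (X.π i $ (xs $ h))
              ≡⟨ cong (g i $_) ($-cong (X.π-⟨⟩ {よ V} _ i) h) ⟩
            g i $ act (X i) h (proj₁ (lifts i))
              ≡⟨ naturality (g i) h _ ⟩
            act (Y i) h (g i $ proj₁ (lifts i))
              ≡⟨ cong (act (Y i) h) (proj₂ (lifts i)) ⟩
            act (Y i) h (Y.π i $ y) ∎)
          (sym (Y.unique {よ V} ys _ λ i → element-natural Y.∏ (Y i) (Y.π i) y))

    -- A thread over `x₀` is built by recursion, all of it at the same maximal `V`.
    dependentChoice : DependentChoice 𝒮
    dependentChoice X p epi L {W} =
      surjective-maximal⇒epi L.lim (X 0) (L.π 0) thread {W}
      where
      module L = SequentialLimit L

      thread : ∀ {V} → Maximal 𝒞 V → (x₀ : X 0 ⟨ V ⟩) → Σ (L.lim ⟨ V ⟩) λ x → L.π 0 $ x ≡ x₀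
      thread {V} max x₀ = l $ idm ,
        trans ($-cong (L.π-⟨⟩ {よ V} _ compatible 0) idm) (element-idm (X 0) x₀)
        where
        lifts : ∀ n (x : X n ⟨ V ⟩) → Σ (X (suc n) ⟨ V ⟩) λ x′ → p n $ x′ ≡ x
        lifts n = epi⇒surjective-maximal (X (suc n)) (X n) (p n) (λ {W} → epi n {W}) max

        xs : ∀ n → X n ⟨ V ⟩
        xs zero = x₀
        xs (suc n) = proj₁ (lifts n (xs n))

        compatible : ∀ n →
          _∙_ {よ V} {X (suc n)} {X n} (p n) (element (X (suc n)) (xs (suc n))) ≡
          element (X n) (xs n)
        compatible n = trans (element-natural (X (suc n)) (X n) (p n) _)
                             (cong (element (X n)) (proj₂ (lifts n (xs n))))

        l : よ V ⇒ L.lim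
        l = L.⟨_⟩ {よ V} (λ n → element (X n) (xs n)) compatible

    -- Every morphism h : V → W being invertible, a map on よ V × Z is determined by its
    -- restriction to the elements (idm , z), which may be chosen freely.
    lift-from-よ× : ∀ X Y (g : X ⇒ Y) → ShEpi {X} {Y} g → ∀ Z {V} → Maximal 𝒞 V →
      let よV×Z = BinaryProduct.A×B (binaryProduct (よ V) Z) in
      (φ : よV×Z ⇒ Y) → Σ (よV×Z ⇒ X) λ ψ → _∙_ {よV×Z} {X} {Y} g ψ ≡ φ
    lift-from-よ× X Y g epi Z {V} max φ = ψ , ⇒-≡ λ (h , z) → begin
      g $ act X h (choose (back h z))
        ≡⟨ naturality g h _ ⟩
      act Y h (g $ choose (back h z))
        ≡⟨ cong (act Y h) (g-choose (back h z)) ⟩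
      act Y h (φ $ (idm , back h z))
        ≡⟨ naturality φ h _ ⟨
      φ $ (h ∘ idm , act Z h (back h z))
        ≡⟨ cong₂ (λ k w → φ $ (k , w)) (idʳ h) (trans (sym (act-∘ Z h (h ⁻¹) z))
             (trans (cong (λ k → act Z k z) (IsIso.invʳ (max h))) (act-id Z z))) ⟩
      φ $ (h , z) ∎
      where
      open ≡-Reasoning

      _⁻¹ : ∀ {W} → Hom V W → Hom W V
      h ⁻¹ = IsIso.inv (max h)

      -- Naturality of `ψ` reduces to this identity.
      ⁻¹-∘ : ∀ {W W′} (k : Hom W W′) (h : Hom V W) → (k ∘ h) ⁻¹ ∘ k ≡ h ⁻¹
      ⁻¹-∘ k h = begin
        (k ∘ h) ⁻¹ ∘ k                 ≡⟨ idʳ _ ⟨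
        ((k ∘ h) ⁻¹ ∘ k) ∘ idm         ≡⟨ cong (((k ∘ h) ⁻¹ ∘ k) ∘_) (IsIso.invʳ (max h)) ⟨
        ((k ∘ h) ⁻¹ ∘ k) ∘ h ∘ h ⁻¹    ≡⟨ assoc _ _ _ ⟨
        (((k ∘ h) ⁻¹ ∘ k) ∘ h) ∘ h ⁻¹  ≡⟨ cong (_∘ h ⁻¹) (assoc _ _ _) ⟩
        ((k ∘ h) ⁻¹ ∘ k ∘ h) ∘ h ⁻¹    ≡⟨ cong (_∘ h ⁻¹) (IsIso.invˡ (max (k ∘ h))) ⟩
        idm ∘ h ⁻¹                     ≡⟨ idˡ _ ⟩
        h ⁻¹                           ∎

      back : ∀ {W} → Hom V W → Z ⟨ W ⟩ → Z ⟨ V ⟩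
      back h z = act Z (h ⁻¹) z

      lifts : (z : Z ⟨ V ⟩) → Σ (X ⟨ V ⟩) λ x → g $ x ≡ φ $ (idm , z)
      lifts z = epi⇒surjective-maximal X Y g (λ {W} → epi {W}) max (φ $ (idm , z))

      choose : Z ⟨ V ⟩ → X ⟨ V ⟩
      choose z = proj₁ (lifts z)

      g-choose : ∀ z → g $ choose z ≡ φ $ (idm , z)
      g-choose z = proj₂ (lifts z)

      ψ : BinaryProduct.A×B (binaryProduct (よ V) Z) ⇒ X
      ψ = record
        { at      = λ _ (h , z) → act X h (choose (back h z))
        ; natural = λ k → ext λ (h , z) → trans
            (cong (λ w → act X (k ∘ h) (choose w))
              (trans (sym (act-∘ Z _ k z)) (cong (λ l → act Z l z) (⁻¹-∘ k h))))
            (act-∘ X k h _)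
        }

    -- By Yoneda and currying, an element of the exponential at `V` is a map out of `よ V` times `Z`,
    -- so lifting it is the task of `lift-from-よ×`.
    internalChoice : InternalChoice 𝒮
    internalChoice X Y g epi Z Xᶻ Yᶻ {W} =
      surjective-maximal⇒epi E.X^Z E′.X^Z gᶻ lift-map {W}
      where
      module E = Exponential Xᶻ
      module E′ = Exponential Yᶻ

      gᶻ : E.X^Z ⇒ E′.X^Z
      gᶻ = exponentialMap 𝒮 {X} {Y} {Z} Xᶻ Yᶻ g

      lift-map : ∀ {V} → Maximal 𝒞 V → (e : E′.X^Z ⟨ V ⟩) → Σ (E.X^Z ⟨ V ⟩) λ d → gᶻ $ d ≡ e
      lift-map {V} max e = ψ̂ $ idm , trans ($-cong gᶻ∙ψ̂≡e idm) (element-idm E′.X^Z e)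
        where
        P : BinaryProduct 𝒮 (よ V) Z
        P = binaryProduct (よ V) Z

        module P = BinaryProduct P

        -- The uncurried form of `e`.
        φ : P.A×B ⇒ Y
        φ = _∙_ {P.A×B} {BinaryProduct.A×B E′.X^Z×Z} {Y} E′.eval
              (_×id 𝒮 {よ V} {E′.X^Z} {Z} {P} {E′.X^Z×Z} (element E′.X^Z e))

        lifted : Σ (P.A×B ⇒ X) λ ψ → _∙_ {P.A×B} {X} {Y} g ψ ≡ φ
        lifted = lift-from-よ× X Y g (λ {W} → epi {W}) Z max φ

        ψ̂ : よ V ⇒ E.X^Z
        ψ̂ = E.curry {よ V} P (proj₁ lifted)

        gᶻ∙ψ̂≡e : _∙_ {よ V} {E.X^Z} {E′.X^Z} gᶻ ψ̂ ≡ element E′.X^Z e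
        gᶻ∙ψ̂≡e = begin
          _∙_ {よ V} {E.X^Z} {E′.X^Z} gᶻ ψ̂
            ≡⟨ exponentialMap-curry 𝒮 {X} {Y} {Z} {よ V} Xᶻ Yᶻ g P (proj₁ lifted) ⟩
          E′.curry {よ V} P (_∙_ {P.A×B} {X} {Y} g (proj₁ lifted))
            ≡⟨ cong (E′.curry {よ V} P) (proj₂ lifted) ⟩
          E′.curry {よ V} P φ
            ≡⟨ E′.unique {よ V} P φ (element E′.X^Z e) refl ⟨
          element E′.X^Z e ∎
          where open ≡-Reasoning

  -- Failure of choice above an object with unbounded sizes

  module FromUnbounded (U : Obj) (large : ∀ b → Σ Obj λ V → Hom U V × b < size V) where

    Above : Set ℓ
    Above = Σ Obj λ V → Hom U V

    -- A larger object `V′` exists above `U`, though perhaps not above `V`; amalgamating the two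
    -- over `U` gives an object above both.
    next : (A : Above) → Σ Obj λ W → Hom (proj₁ A) W × size (proj₁ A) < size W
    next (V , f) with large (size V)
    ... | V′ , f′ , V<V′ with amalgamate f f′
    ...   | W , h , k , _ = W , h , <-≤-trans V<V′ (size-mono k)

    chain : ℕ → Above
    chain zero = U , idm
    chain (suc n) = let W , h , _ = next (chain n) in W , h ∘ proj₂ (chain n)

    D : ℕ → Obj
    D n = proj₁ (chain n)

    from-U : ∀ n → Hom U (D n)
    from-U n = proj₂ (chain n)

    step : ∀ n → Hom (D n) (D (suc n))
    step n = proj₁ (proj₂ (next (chain n)))

    n≤size : ∀ n → n ≤ size (D n)
    n≤size zero = z≤n
    n≤size (suc n) = ≤-trans (s≤s (n≤size n)) (proj₂ (proj₂ (next (chain n))))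

    no-cocone : ∀ {V} → ¬ (∀ n → Hom (D n) V)
    -- Stage `suc (size V)` of the chain is already larger than `V`.
    no-cocone {V} f = 1+n≰n (≤-trans (n≤size (suc (size V))) (size-mono (f (suc (size V)))))

    precompose-epi : ∀ {A B} (f : Hom A B) → ShEpi {よ B} {よ A} (precompose f)
    precompose-epi {A} {B} f {W} = locallySurjective⇒epi (よ B) (よ A) (precompose f)
      (precompose-locallySurjective f) {W}

    -- A local lift of the family of identities of `U` consists of morphisms from all `D n` into one
    -- object.
    ¬countableChoice : ¬ CountableChoice 𝒮
    ¬countableChoice choice = no-cocone (proj₁ (proj₂ (proj₂ (surjective {U} λ _ → idm))))
      where
      X Y : ℕ → ShObj
      X n = よ (D n)
      Y n = よ U

      g : ∀ n → X n ⇒ Y n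
      g n = precompose (from-U n)

      surjective : LocallySurjective (∏ˢ X) (∏ˢ Y) (productMap 𝒮 (product X) (product Y) g)
      surjective = epi⇒locallySurjective em (∏ˢ X) (∏ˢ Y) _ λ {W} →
        choice X Y g (λ n {W} → precompose-epi (from-U n) {W}) (product X) (product Y) {W}

    -- A cone over the chain would give cocones under D, so the limit is empty.
    ¬dependentChoice : ¬ DependentChoice 𝒮
    -- `D 0` is `U`, so the identity is an element of `X 0`; a local lift of it would lie in the
    -- empty sheaf.
    ¬dependentChoice choice = lower (proj₁ (proj₂ (proj₂ (surjective {U} idm))))
      where
      X : ℕ → ShObj
      X n = よ (D n)

      ∅ : ShObj
      ∅ = constant (Lift ℓ ⊥)

      empty : ∀ {W} → (∀ n → W ⇒ X n) → ∀ {V} → ¬ (W ⟨ V ⟩)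
      empty f w = no-cocone (λ n → f n $ w)

      limit : SequentialLimit 𝒮 X (λ n → precompose (step n))
      limit = record
        { lim    = ∅
        ; π      = λ _ → record { at = λ _ () ; natural = λ _ → ext λ () }
        ; cone   = λ _ → ⇒-≡ λ ()
        ; ⟨_⟩    = λ {W} f _ → record
          { at      = λ _ w → lift (empty {W} f w)
          ; natural = λ _ → ext λ w → ⊥-elim (empty {W} f w)
          }
        ; π-⟨⟩   = λ {W} f _ n → ⇒-≡ λ w → ⊥-elim (empty {W} f w)
        ; unique = λ {W} f _ u _ → ⇒-≡ λ w → ⊥-elim (empty {W} f w)
        }

      surjective : LocallySurjective ∅ (X 0) (SequentialLimit.π limit 0)
      surjective = epi⇒locallySurjective em ∅ (X 0) _ λ {W} →
        choice X (λ n → precompose (step n)) (λ n {W} → precompose-epi (step n) {W}) limit {W}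

    -- Coproducts combine the countably many epimorphisms into one, and exponentiation by `N` asks
    -- for lifts of sequences. The sequence to lift visits each summand once, at its identity.
    ¬internalChoice : ¬ InternalChoice 𝒮
    ¬internalChoice choice = absurd (surjective {U} λ n → n , idm)
      where
      X Y : ℕ → ShObj
      X n = よ (D n)
      Y n = よ U

      g : ∐ X ⇒ ∐ Y
      g = ∐-map X Y λ n → precompose (from-U n)

      g-epi : ShEpi {∐ X} {∐ Y} g
      g-epi {W} = locallySurjective⇒epi (∐ X) (∐ Y) g
        (∐-map-locallySurjective X Y (λ n → precompose (from-U n)) λ n →
          precompose-locallySurjective (from-U n)) {W}

      Xᴺ Yᴺ : ShObj
      Xᴺ = Exponential.X^Z (power (∐ X))
      Yᴺ = Exponential.X^Z (power (∐ Y))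

      gᴺ : Xᴺ ⇒ Yᴺ
      gᴺ = exponentialMap 𝒮 (power (∐ X)) (power (∐ Y)) g

      surjective : LocallySurjective Xᴺ Yᴺ gᴺ
      surjective = epi⇒locallySurjective em Xᴺ Yᴺ gᴺ λ {W} →
        choice (∐ X) (∐ Y) g (λ {W} → g-epi {W}) N (power (∐ X)) (power (∐ Y)) {W}

      absurd : ¬ LiftsLocally Xᴺ Yᴺ gᴺ {U} (λ n → n , idm)
      absurd (V , f , x , gx≡fy) = no-cocone λ n →
        -- `g` preserves summands, so the `n`-th term of the lift lies in summand `n` and is a
        -- morphism out of `D n`.
        subst (λ m → Hom (D m) V)
          (trans (cong proj₁ (sym (power-map (∐ X) (∐ Y) g x n)))
                 (cong (λ y → proj₁ (y n)) gx≡fy))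
          (proj₂ (x n))

  -- Classically, if no number bounds the sizes above `U`, every number is exceeded above `U`, which
  -- is the input of the refutations.
  refute-unbounded : ∀ {a} {A : Set a} → A →
    (∀ U → (∀ b → Σ Obj λ V → Hom U V × b < size V) → ¬ A) → Bounded 𝒞 size
  refute-unbounded a refute U with em {P = Σ ℕ λ b → ∀ {V} → Hom U V → size V ≤ b}
  ... | yes bound = bound
  ... | no unbounded = ⊥-elim (refute U large a)
    where
    large : ∀ b → Σ Obj λ V → Hom U V × b < size V
    large b with em {P = Σ Obj λ V → Hom U V × b < size V}
    ... | yes V = V
    ... | no none = ⊥-elim (unbounded (b , λ f → ≮⇒≥ λ b<V → none (_ , f , b<V)))

-- Transfer along an equivalence

module Transfer {o h o′ h′} {𝒞 : Category o h} {𝒟 : Category o′ h′} (E : Equivalence 𝒞 𝒟) where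
  open Category 𝒞
  open Equivalence E
  private
    module D = Category 𝒟
    module T = Functor to
    module S = Functor from
    module η = NatTrans (NatIso.natTrans unit)
    module η-iso U = IsIso (NatIso.isIso unit U)
    module ε-iso A = D.IsIso (NatIso.isIso counit A)

  η⁻¹ : ∀ U → Hom U (S.F₀ (T.F₀ U))
  η⁻¹ U = η-iso.inv U

  ε⁻¹ : ∀ A → D.Hom A (T.F₀ (S.F₀ A))
  ε⁻¹ A = ε-iso.inv A

  to-faithful : Faithful to
  to-faithful f g e = naturallyIdentity⇒faithful 𝒞 unit f g (cong S.F₁ e)

  from-faithful : Faithful from
  from-faithful f g e = naturallyIdentity⇒faithful 𝒟 counit f g (cong T.F₁ e)

  -- The hom-set comparison of the adjunction between `to` and `from`; it handles morphisms into
  -- objects outside the image of `to`.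
  transpose : ∀ {U A} → D.Hom (T.F₀ U) A → Hom U (S.F₀ A)
  transpose {U} g = S.F₁ g ∘ η⁻¹ U

  η⁻¹-natural : ∀ {U V} (f : Hom U V) → S.F₁ (T.F₁ f) ∘ η⁻¹ U ≡ η⁻¹ V ∘ f
  η⁻¹-natural {U} {V} f = iso-cancelʳ 𝒞 (NatIso.isIso unit U) (begin
    (S.F₁ (T.F₁ f) ∘ η⁻¹ U) ∘ η.at U     ≡⟨ assoc _ _ _ ⟩
    S.F₁ (T.F₁ f) ∘ η⁻¹ U ∘ η.at U       ≡⟨ cong (S.F₁ (T.F₁ f) ∘_) (η-iso.invˡ U) ⟩
    S.F₁ (T.F₁ f) ∘ idm                  ≡⟨ idʳ _ ⟩
    S.F₁ (T.F₁ f)                        ≡⟨ idˡ _ ⟨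
    idm ∘ S.F₁ (T.F₁ f)                  ≡⟨ cong (_∘ S.F₁ (T.F₁ f)) (η-iso.invˡ V) ⟨
    (η⁻¹ V ∘ η.at V) ∘ S.F₁ (T.F₁ f)     ≡⟨ assoc _ _ _ ⟩
    η⁻¹ V ∘ η.at V ∘ S.F₁ (T.F₁ f)       ≡⟨ cong (η⁻¹ V ∘_) (η.natural f) ⟩
    η⁻¹ V ∘ f ∘ η.at U                   ≡⟨ assoc _ _ _ ⟨
    (η⁻¹ V ∘ f) ∘ η.at U                 ∎)
    where open ≡-Reasoning

  transpose-∘ : ∀ {U V A} (g : D.Hom (T.F₀ V) A) (f : Hom U V) →
                transpose g ∘ f ≡ transpose (g D.∘ T.F₁ f)
  transpose-∘ {U} {V} g f = begin
    (S.F₁ g ∘ η⁻¹ V) ∘ f                 ≡⟨ assoc _ _ _ ⟩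
    S.F₁ g ∘ η⁻¹ V ∘ f                   ≡⟨ cong (S.F₁ g ∘_) (η⁻¹-natural f) ⟨
    S.F₁ g ∘ S.F₁ (T.F₁ f) ∘ η⁻¹ U       ≡⟨ assoc _ _ _ ⟨
    (S.F₁ g ∘ S.F₁ (T.F₁ f)) ∘ η⁻¹ U     ≡⟨ cong (_∘ η⁻¹ U) (S.F-comp g (T.F₁ f)) ⟨
    S.F₁ (g D.∘ T.F₁ f) ∘ η⁻¹ U          ∎
    where open ≡-Reasoning

  transpose-injective : ∀ {U A} {g k : D.Hom (T.F₀ U) A} → transpose g ≡ transpose k → g ≡ k
  transpose-injective {U} e = from-faithful _ _
    (iso-cancelʳ 𝒞 (record { inv = η.at U ; invˡ = η-iso.invʳ U ; invʳ = η-iso.invˡ U }) e)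

  transpose-square : ∀ {U V V′ A} {g : D.Hom (T.F₀ V) A} {f : Hom U V}
    {g′ : D.Hom (T.F₀ V′) A} {f′ : Hom U V′} →
    g D.∘ T.F₁ f ≡ g′ D.∘ T.F₁ f′ → transpose g ∘ f ≡ transpose g′ ∘ f′
  transpose-square e =
    trans (transpose-∘ _ _) (trans (cong transpose e) (sym (transpose-∘ _ _)))

  transpose-square⁻¹ : ∀ {U V V′ A} {g : D.Hom (T.F₀ V) A} {f : Hom U V}
    {g′ : D.Hom (T.F₀ V′) A} {f′ : Hom U V′} →
    transpose g ∘ f ≡ transpose g′ ∘ f′ → g D.∘ T.F₁ f ≡ g′ D.∘ T.F₁ f′
  transpose-square⁻¹ e = transpose-injective
    (trans (sym (transpose-∘ _ _)) (trans e (transpose-∘ _ _)))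

  -- The preimage is `S.F₁ x` conjugated by the unit; the equation is checked after transposing.
  to-full : ∀ {U V} (x : D.Hom (T.F₀ U) (T.F₀ V)) → Σ (Hom U V) λ y → T.F₁ y ≡ x
  to-full {U} {V} x = η.at V ∘ transpose x , transpose-injective (begin
    transpose (T.F₁ (η.at V ∘ transpose x))  ≡⟨ η⁻¹-natural _ ⟩
    η⁻¹ V ∘ η.at V ∘ transpose x             ≡⟨ assoc _ _ _ ⟨
    (η⁻¹ V ∘ η.at V) ∘ transpose x           ≡⟨ cong (_∘ transpose x) (η-iso.invˡ V) ⟩
    idm ∘ transpose x                        ≡⟨ idˡ _ ⟩
    transpose x                              ∎)
    where open ≡-Reasoning

  hasAmalgamation : HasAmalgamation 𝒟 → HasAmalgamation 𝒞
  hasAmalgamation amalgamate f g with amalgamate (T.F₁ f) (T.F₁ g)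
  ... | A , h , k , e = S.F₀ A , transpose h , transpose k , transpose-square e

  allMono : AllMono 𝒟 → AllMono 𝒞
  allMono mono f x y e = to-faithful x y (mono (T.F₁ f) _ _
    (trans (sym (T.F-comp f x)) (trans (cong T.F₁ e) (T.F-comp f y))))

  allStrict : AllStrict 𝒟 → AllStrict 𝒞
  allStrict strict f s d
    with strict (T.F₁ f) (T.F₁ s)
           -- Strictness in `𝒟` tests against pairs into arbitrary objects of `𝒟`; transposing turns
           -- them into test pairs in `𝒞`.
           (λ g k e → transpose-square⁻¹ (d (transpose g) (transpose k) (transpose-square e)))
  ... | x , fx≡s with to-full x
  ...   | y , refl = y , to-faithful _ _ (trans (T.F-comp f y) fx≡s)

  to-reflects-iso : ∀ {U V} (f : Hom U V) → D.IsIso (T.F₁ f) → IsIso f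
  to-reflects-iso f iso with to-full (D.IsIso.inv iso)
  ... | g , Tg≡inv = record
    { inv  = g
    ; invˡ = to-faithful _ _ (trans (T.F-comp g f)
        (trans (cong (D._∘ T.F₁ f) Tg≡inv) (trans (D.IsIso.invˡ iso) (sym T.F-id))))
    ; invʳ = to-faithful _ _ (trans (T.F-comp f g)
        (trans (cong (T.F₁ f D.∘_) Tg≡inv) (trans (D.IsIso.invʳ iso) (sym T.F-id))))
    }

-- Finite structures

-- Pigeonhole: were `j` missed, punching it out would inject `Fin m` into a set with fewer elements.
injective∧≤⇒surjective : ∀ {m n} {f : Fin m → Fin n} → Injective _≡_ _≡_ f →
                         n ≤ m → ∀ j → Σ (Fin m) λ i → f i ≡ j
injective∧≤⇒surjective {m} {suc n} {f} f-injective n<m j with any? (λ i → f i ≟ j)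
... | yes hit = hit
... | no missed = ⊥-elim (<⇒≱ n<m (injective⇒≤ punched-injective))
  where
  j≢f : ∀ i → ¬ (j ≡ f i)
  j≢f i j≡fi = missed (i , sym j≡fi)

  punched-injective : Injective _≡_ _≡_ (λ i → punchOut (j≢f i))
  punched-injective e = f-injective (punchOut-injective (j≢f _) (j≢f _) e)

module _ {a b} {X : Set a} {Y : Set b} (X-finite : Finite X) (Y-finite : Finite Y)
         {f : X → Y} (f-injective : Injective _≡_ _≡_ f) where
  private
    module X = Inverse (proj₂ X-finite)
    module Y = Inverse (proj₂ Y-finite)

    index-map : Fin (card X-finite) → Fin (card Y-finite)
    index-map i = Y.to (f (X.from i))

    index-map-injective : Injective _≡_ _≡_ index-map
    index-map-injective {i} {j} e = trans (sym (X.strictlyInverseˡ i)) (trans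
      (cong X.to (f-injective (trans (sym (Y.strictlyInverseʳ _))
        (trans (cong Y.from e) (Y.strictlyInverseʳ _)))))
      (X.strictlyInverseˡ j))

  injective⇒card-≤ : card X-finite ≤ card Y-finite
  injective⇒card-≤ = injective⇒≤ index-map-injective

  injective∧card-≥⇒surjective : card Y-finite ≤ card X-finite → Surjective _≡_ _≡_ f
  injective∧card-≥⇒surjective Y≤X y
    with injective∧≤⇒surjective index-map-injective Y≤X (Y.to y)
  ... | i , e = X.from i , λ { refl →
    trans (sym (Y.strictlyInverseʳ _)) (trans (cong Y.from e) (Y.strictlyInverseʳ y)) }

-- Embeddings and connected components of a structure-class

module _ (ext : FunExt) {ℓ} (𝒦 : StructureClass ℓ) where
  open StructureClass 𝒦

  embeddings-mono : AllMono category
  embeddings-mono f x y e = faithful x y (ext λ a → injective f (cong-app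
    (trans (sym (∣∣-comp f x)) (trans (cong ∣_∣₁ e) (∣∣-comp f y))) a))

  embeddings-strict : Subcanonical ext (op category) (atomic (op category)) →
                      AllStrict category
  embeddings-strict subcanonical {A} f s d
    with subcanonical A (singleton category f) (lift tt) (λ _ → s) (λ _ _ → d)
  ... | x , e , _ = x , e (lift tt)

module _ {ℓ} (𝒦 : StructureClass ℓ) (amalgamate : Amalgamation 𝒦) where
  open StructureClass 𝒦

  -- Induction on the zigzag: a forward step is composed with the cospan, a backward step is
  -- amalgamated with it.
  sameComponent⇒cospan : ∀ {A B} → SameComponent 𝒦 A B → Σ Obj λ D → Hom A D × Hom B D
  sameComponent⇒cospan ε = _ , idm , idm
  sameComponent⇒cospan (fwd f ◅ path) with sameComponent⇒cospan path
  ... | D , g , k = D , g ∘ f , k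
  sameComponent⇒cospan (bwd f ◅ path) with sameComponent⇒cospan path
  ... | D , g , k with amalgamate f g
  ...   | W , h , l , _ = W , h , l ∘ k

theorem7p9 : (ext : FunExt) (em : ∀ {a} → ExcludedMiddle a) →
    ∀ {ℓ} (𝒦 : StructureClass ℓ) → SubcanonicalAPClass 𝒦 ext →
    (fin : FiniteStructures 𝒦) →
    (𝒞 : Category ℓ ℓ) → Equivalence 𝒞 (StructureClass.category 𝒦) →
    let Sh𝒦ᵒᵖ = Sh ext (op 𝒞) (atomic (op 𝒞)) in
    (BoundedOnComponents 𝒦 fin ⇔ CountableChoice Sh𝒦ᵒᵖ) ×
    (CountableChoice Sh𝒦ᵒᵖ ⇔ DependentChoice Sh𝒦ᵒᵖ) ×
    (DependentChoice Sh𝒦ᵒᵖ ⇔ InternalChoice Sh𝒦ᵒᵖ)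
theorem7p9 ext em 𝒦 apClass fin 𝒞 equiv =
    -- All implications between choice principles pass through boundedness.
    mk⇔ (λ b → C.FromBounded.countableChoice (bounded b))
        (λ cc → boundedOnComponents (cc⇒bounded cc))
  , mk⇔ (λ cc → C.FromBounded.dependentChoice (cc⇒bounded cc))
        (λ dc → C.FromBounded.countableChoice (dc⇒bounded dc))
  , mk⇔ (λ dc → C.FromBounded.internalChoice (dc⇒bounded dc))
        (λ ic → C.FromBounded.dependentChoice (ic⇒bounded ic))
  where
  open StructureClass 𝒦
  open SubcanonicalAPClass apClass
  open Equivalence equiv using (to; from)
  open Transfer equiv
  module T = Functor to
  module S = Functor from

  size : Category.Obj 𝒞 → ℕ
  size U = card (fin (T.F₀ U))

  card-mono : ∀ {A B} → Hom A B → card (fin A) ≤ card (fin B)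
  card-mono {A} {B} f = injective⇒card-≤ (fin A) (fin B) (injective f)

  -- An injection between finite sets that does not increase the size is bijective, so `reflects`
  -- inverts the embedding in `𝒦`, and full faithfulness of `to` brings the inverse back to `𝒞`.
  size-iso : ∀ {U V} (f : Category.Hom 𝒞 U V) → size V ≤ size U → Category.IsIso 𝒞 f
  size-iso f V≤U = to-reflects-iso f (reflects (T.F₁ f)
    ( injective (T.F₁ f)
    , injective∧card-≥⇒surjective (fin _) (fin _) (injective (T.F₁ f)) V≤U ))

  module C = Choice ext em 𝒞 (hasAmalgamation amalgamation)
    (allMono (embeddings-mono ext 𝒦)) (allStrict (embeddings-strict ext 𝒦 subcanonical))
    size (λ f → card-mono (T.F₁ f)) size-iso

  𝒮 : Category _ _
  𝒮 = Sh ext (op 𝒞) (atomic (op 𝒞))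

  cc⇒bounded : CountableChoice 𝒮 → Bounded 𝒞 size
  cc⇒bounded cc = C.refute-unbounded cc C.FromUnbounded.¬countableChoice

  dc⇒bounded : DependentChoice 𝒮 → Bounded 𝒞 size
  dc⇒bounded dc = C.refute-unbounded dc C.FromUnbounded.¬dependentChoice

  ic⇒bounded : InternalChoice 𝒮 → Bounded 𝒞 size
  ic⇒bounded ic = C.refute-unbounded ic C.FromUnbounded.¬internalChoice

  bounded : BoundedOnComponents 𝒦 fin → Bounded 𝒞 size
  bounded bound U with bound (T.F₀ U)
  ... | b , card≤b = b , λ f → card≤b _ (fwd (T.F₁ f) ◅ ε)

  boundedOnComponents : Bounded 𝒞 size → BoundedOnComponents 𝒦 fin
  boundedOnComponents bound A₀ with bound (S.F₀ A₀)
  ... | b , size≤b = b , λ A path →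
    -- `A` embeds into some `D` above `A₀`, and via `ε⁻¹` into `T.F₀ (S.F₀ D)`, whose size is
    -- bounded because `S.F₁ f` places `S.F₀ D` above `S.F₀ A₀`.
    let D , f , g = sameComponent⇒cospan 𝒦 amalgamation path in
    ≤-trans (card-mono (ε⁻¹ D ∘ g)) (size≤b (S.F₁ f))
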